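{- Let $\ell\ge 0$ and fix real numbers $a_0=0<a_1<\dots<a_\ell<a_{\ell+1}\le 1$ and $0<p_i<1$, $0\le q_i\le 1$ for $i\in\{1,\dots,\ell+1\}$. Let $g_i(x)=p_ix+q_i$ and assume $g_i(a_i)=a_i$ for all $i\in\{1,\dots,\ell+1\}$. Let $g\colon[0,1]\to[0,1]$ be the function with $g(x)=g_i(x)$ if $a_{i-1}\le x<a_i$ and $g(x)=g_{\ell+1}(x)$ if $a_\ell\le x$. Let $c=\min_i\frac{1-p_i}{p_i}$ and, for $v,b,l\in[0,1]$, let $\mathit{decrease}(v,b,l)$ hold iff - $l=a_i$ for some $i\in\{0,\dots,\ell\}$; or - $a_\ell\le b$ and $b-l\ge c\cdot(v-b)$; or - $a_i\le b<a_{i+1}$ and $b-l\ge c\cdot(a_{i+1}-b)$ for some $i\in\{0,\dots,\ell-1\}$. Then the modified game for the single equation $x=_\mu g(x)$ over the lattice $[0,1]$ is complete, i.e. $\exists$ has a winning strategy for all $v\le\mu g$. The same holds for any monotone function $f\colon[0,1]\to[0,1]$ with $f\ge g$ and $\mu f=a_{\ell+1}$: in the modified game for $x=_\mu f(x)$, with the same predicate $\mathit{decrease}$, $\exists$ has a winning strategy for all $v\le\mu f$.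
   Context: $\mu f$ denotes the least fixpoint of $f$. The lattice is the real interval $[0,1]$ with the usual order $\le$, with a fixed basis $B\subseteq[0,1]$ (every element of $[0,1]$ is the supremum of the elements of $B$ below it) with $0\notin B$. The way-below relation is: $x\ll y$ iff $x<y$ or $x=0$. Modified game for a single equation $x=_\mu f(x)$ and a predicate $\mathit{decrease}\subseteq[0,1]^3$, starting from $v\in[0,1]$: player $\forall$ chooses $b\in B$ with $b\ll v$; player $\exists$ chooses $l\in[0,1]$ with $b\le f(l)$; then $\exists$ wins if $l\le b$ and $\mathit{decrease}(v,b,l)$ hold, and otherwise $\forall$ wins. A player who is unable to move loses. -}

module Defs where

open import Level using (Level; _⊔_) renaming (suc to lsuc)
open import Algebra.Bundles using (CommutativeRing)
open import Algebra.Core using (Op₁; Op₂)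
open import Algebra.Structures using (IsCommutativeRing)
open import Data.Fin.Base using (Fin; zero; suc; inject₁; fromℕ)
open import Data.List.Base using (tabulate)
open import Data.Nat.Base using (ℕ)
open import Data.Product.Base using (_×_; Σ-syntax; ∃)
open import Data.Sum.Base using (_⊎_)
open import Relation.Binary.Bundles using (DecTotalOrder)
open import Relation.Binary.Core using (Rel)
open import Relation.Binary.Structures using (IsDecTotalOrder)
open import Relation.Nullary.Negation using (¬_)
open import Relation.Unary using (Pred; _∈_)
import Data.List.Extrema as Extrema
import Relation.Binary.Construct.NonStrictToStrict as ToStrict

------------------------------------------------------------------------
-- Suprema of subsets

module _ {a r : Level} {A : Set a} (_≤_ : Rel A r) where

  IsUpperBound : ∀ {s} → Pred A s → A → Set (a ⊔ r ⊔ s)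
  IsUpperBound S u = ∀ x → x ∈ S → x ≤ u

  IsSupremum : ∀ {s} → Pred A s → A → Set (a ⊔ r ⊔ s)
  IsSupremum S u = IsUpperBound S u × (∀ w → IsUpperBound S w → u ≤ w)

------------------------------------------------------------------------
-- The real numbers, given by their classical axioms: a Dedekind-complete
-- totally ordered field, which is unique up to isomorphism.  The order is
-- decidable because the mathematics is classical (g is defined by cases on
-- the order of reals).

record CompleteOrderedField (c ℓ₁ ℓ₂ : Level) : Set (lsuc (c ⊔ ℓ₁ ⊔ ℓ₂)) where
  infix  8 _⁻¹ -_
  infixl 7 _*_
  infixl 6 _+_
  infix  4 _≈_ _≤_
  field
    Carrier           : Set c
    _≈_               : Rel Carrier ℓ₁
    _≤_               : Rel Carrier ℓ₂
    _+_ _*_           : Op₂ Carrier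
    -_                : Op₁ Carrier
    0# 1#             : Carrier
    isCommutativeRing : IsCommutativeRing _≈_ _+_ _*_ -_ 0# 1#
    isDecTotalOrder   : IsDecTotalOrder _≈_ _≤_
    0≉1               : ¬ (0# ≈ 1#)
    -- Total inverse; its value at 0# is unconstrained.
    _⁻¹               : Op₁ Carrier
    *-inverseʳ        : ∀ x → ¬ (x ≈ 0#) → x * (x ⁻¹) ≈ 1#
    +-monoˡ-≤         : ∀ z {x y} → x ≤ y → x + z ≤ y + z
    *-nonNeg          : ∀ {x y} → 0# ≤ x → 0# ≤ y → 0# ≤ x * y
    complete          : (S : Pred Carrier (c ⊔ ℓ₁ ⊔ ℓ₂)) →
                        ∃ S → ∃ (IsUpperBound _≤_ S) → ∃ (IsSupremum _≤_ S)

  commutativeRing : CommutativeRing c ℓ₁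
  commutativeRing = record { isCommutativeRing = isCommutativeRing }

  decTotalOrder : DecTotalOrder c ℓ₁ ℓ₂
  decTotalOrder = record { isDecTotalOrder = isDecTotalOrder }

  open CommutativeRing commutativeRing public using (_-_)

  open DecTotalOrder decTotalOrder public using (totalOrder)

  open ToStrict _≈_ _≤_ public using (_<_)

  open Extrema totalOrder public using (min)

module UnitInterval {c ℓ₁ ℓ₂ : Level} (ℝ : CompleteOrderedField c ℓ₁ ℓ₂) where

  open CompleteOrderedField ℝ

  record 𝕀 : Set (c ⊔ ℓ₂) where
    field
      val   : Carrier
      0≤val : 0# ≤ val
      val≤1 : val ≤ 1#

  open 𝕀 public

  infix 4 _≈ᴵ_ _≤ᴵ_ _<ᴵ_ _≪_

  _≈ᴵ_ : Rel 𝕀 ℓ₁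
  x ≈ᴵ y = val x ≈ val y

  _≤ᴵ_ : Rel 𝕀 ℓ₂
  x ≤ᴵ y = val x ≤ val y

  _<ᴵ_ : Rel 𝕀 (ℓ₁ ⊔ ℓ₂)
  x <ᴵ y = val x < val y

  _≪_ : Rel 𝕀 (ℓ₁ ⊔ ℓ₂)
  x ≪ y = x <ᴵ y ⊎ val x ≈ 0#

  IsBasis : ∀ {β} → Pred 𝕀 β → Set (c ⊔ ℓ₂ ⊔ β)
  IsBasis B = ∀ x → IsSupremum _≤ᴵ_ (λ b → b ∈ B × b ≤ᴵ x) x

  -- Monotone maps respect ≈ᴵ, by antisymmetry.
  Monotone : (𝕀 → 𝕀) → Set (c ⊔ ℓ₂)
  Monotone f = ∀ {x y} → x ≤ᴵ y → f x ≤ᴵ f y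

  IsLeastFixpoint : (𝕀 → 𝕀) → 𝕀 → Set (c ⊔ ℓ₁ ⊔ ℓ₂)
  IsLeastFixpoint f m = f m ≈ᴵ m × (∀ x → f x ≈ᴵ x → m ≤ᴵ x)

  ----------------------------------------------------------------------
  -- The modified game for x =μ f(x).  Strategies contain legal moves
  -- only: if ∃ has no legal reply to some move there is no strategy, and if
  -- ∀ has no legal move every strategy is winning.

  module Game {β δ : Level} (B : Pred 𝕀 β) (decrease : 𝕀 → 𝕀 → 𝕀 → Set δ)
              (f : 𝕀 → 𝕀) where

    record Move∀ (v : 𝕀) : Set (c ⊔ ℓ₁ ⊔ ℓ₂ ⊔ β) where
      field
        b   : 𝕀
        b∈B : b ∈ B
        b≪v : b ≪ v

    record Move∃ (b : 𝕀) : Set (c ⊔ ℓ₂) where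
      field
        l    : 𝕀
        b≤fl : b ≤ᴵ f l

    open Move∀
    open Move∃

    Strategy∃ : 𝕀 → Set (c ⊔ ℓ₁ ⊔ ℓ₂ ⊔ β)
    Strategy∃ v = (m : Move∀ v) → Move∃ (b m)

    Winning∃ : ∀ {v} → Strategy∃ v → Set (c ⊔ ℓ₁ ⊔ ℓ₂ ⊔ β ⊔ δ)
    Winning∃ {v} σ = ∀ m → l (σ m) ≤ᴵ b m × decrease v (b m) (l (σ m))

    ∃-wins : 𝕀 → Set (c ⊔ ℓ₁ ⊔ ℓ₂ ⊔ β ⊔ δ)
    ∃-wins v = Σ[ σ ∈ Strategy∃ v ] Winning∃ σ

    Complete : Set (c ⊔ ℓ₁ ⊔ ℓ₂ ⊔ β ⊔ δ)
    Complete = ∀ μf → IsLeastFixpoint f μf → ∀ v → v ≤ᴵ μf → ∃-wins v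

  ----------------------------------------------------------------------
  -- For i : Fin (suc n), standing for the index toℕ i + 1 ∈ {1,…,n+1}:
  --   p i, q i       are  p_{toℕ i + 1}, q_{toℕ i + 1},
  --   a (inject₁ i)  is   a_{toℕ i},
  --   a (suc i)      is   a_{toℕ i + 1}.

  record Pieces (n : ℕ) : Set (c ⊔ ℓ₁ ⊔ ℓ₂) where
    field
      a       : Fin (ℕ.suc (ℕ.suc n)) → Carrier
      p q     : Fin (ℕ.suc n) → Carrier
      a₀≈0    : a zero ≈ 0#
      a-mono  : ∀ i → a (inject₁ i) < a (suc i)
      aₙ₊₁≤1  : a (fromℕ (ℕ.suc n)) ≤ 1#
      0<p     : ∀ i → 0# < p i
      p<1     : ∀ i → p i < 1#
      0≤q     : ∀ i → 0# ≤ q i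
      q≤1     : ∀ i → q i ≤ 1#

    piece : Fin (ℕ.suc n) → Carrier → Carrier
    piece i x = p i * x + q i

    field
      piece-fix : ∀ i → piece i (a (suc i)) ≈ a (suc i)

    aₙ aₙ₊₁ : Carrier
    aₙ   = a (inject₁ (fromℕ n))
    aₙ₊₁ = a (fromℕ (ℕ.suc n))

    IsPiecewise : (𝕀 → 𝕀) → Set (c ⊔ ℓ₁ ⊔ ℓ₂)
    IsPiecewise g =
      (∀ x i → a (inject₁ i) ≤ val x → val x < a (suc i) →
         val (g x) ≈ piece i (val x)) ×
      (∀ x → aₙ ≤ val x → val (g x) ≈ piece (fromℕ n) (val x))

    ratio : Fin (ℕ.suc n) → Carrier
    ratio i = (1# - p i) * (p i) ⁻¹

    -- min_i (1 - p_i)/p_i; the seed passed to min is itself one of the ratios.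
    minRatio : Carrier
    minRatio = min (ratio zero) (tabulate ratio)

    decrease : 𝕀 → 𝕀 → 𝕀 → Set (ℓ₁ ⊔ ℓ₂)
    decrease v b l =
      (Σ[ i ∈ Fin (ℕ.suc n) ] val l ≈ a (inject₁ i)) ⊎
      (aₙ ≤ val b × minRatio * (val v - val b) ≤ val b - val l) ⊎
      (Σ[ i ∈ Fin n ]
         a (inject₁ (inject₁ i)) ≤ val b ×
         val b < a (suc (inject₁ i)) ×
         minRatio * (a (suc (inject₁ i)) - val b) ≤ val b - val l)

-- On the piece with index i, which is affine with slope p, fixed point a and
-- left end a′, put r = (1 - p)/p.  The g-preimage of b < a is
-- l₀ = b - r (a - b), so that b - l₀ = r (a - b) ≥ c (a - b).  Hence ∃ answers
-- b with l₀ if a′ ≤ l₀, and with a′ otherwise; in the second case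
-- g a′ ≥ b because g is increasing on the piece.
module Submission where

open import Defs
open import Algebra.Bundles using (CommutativeRing)
open import Data.Fin.Base using (Fin; zero; suc; inject₁; fromℕ)
open import Data.Fin.Induction using (<-weakInduction)
open import Data.Fin.Relation.Unary.Top using (view; ‵fromℕ; ‵inject₁)
open import Data.List.Base using (tabulate)
open import Data.List.Relation.Unary.All.Properties using (tabulate⁻)
open import Data.Nat.Base using (ℕ)
open import Data.Product.Base using (_×_; _,_; Σ-syntax; proj₁; proj₂)
open import Data.Sum.Base using (_⊎_; inj₁; inj₂)
open import Level using (Level)
open import Relation.Binary.Bundles using (DecTotalOrder)
open import Relation.Nullary.Decidable.Core using (yes; no)
open import Relation.Nullary.Negation using (¬_; contradiction)
open import Relation.Unary using (Pred; _∈_)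
import Algebra.Properties.Group as GroupProperties
import Algebra.Properties.Ring as RingProperties
import Algebra.Solver.Ring.NaturalCoefficients.Default as NaturalCoefficients
import Data.List.Extrema as Extrema
import Relation.Binary.Properties.DecTotalOrder as DecTotalOrderProperties
import Relation.Binary.Reasoning.PartialOrder as PartialOrderReasoning

-- Ordered-field arithmetic, and locating a point among breakpoints.

module OrderedFieldProperties {c ℓ₁ ℓ₂ : Level} (ℝ : CompleteOrderedField c ℓ₁ ℓ₂) where

  open CompleteOrderedField ℝ
  open CommutativeRing commutativeRing public
    using (ring; commutativeSemiring; +-group; +-identityˡ;
           +-congˡ; +-congʳ; +-comm; *-congˡ; *-congʳ; *-comm; *-assoc;
           *-identityˡ; -‿inverseʳ; zeroˡ; refl; sym; trans)
  open DecTotalOrder decTotalOrder public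
    using (poset; antisym; total; reflexive; _≤?_)
    renaming (refl to ≤-refl; trans to ≤-trans)
  open DecTotalOrderProperties decTotalOrder public using (≰⇒>; ≰⇒≥)
  open GroupProperties +-group using (//-rightDividesˡ; ∙-cancelʳ)
  open RingProperties ring using (x[y-z]≈xy-xz)
  open NaturalCoefficients commutativeSemiring
  open PartialOrderReasoning poset

  x-y+y≈x : ∀ x y → x - y + y ≈ x
  x-y+y≈x x y = //-rightDividesˡ y x

  x≤y⇒0≤y-x : ∀ {x y} → x ≤ y → 0# ≤ y - x
  x≤y⇒0≤y-x {x} {y} x≤y = begin
    0#     ≈⟨ -‿inverseʳ x ⟨
    x - x  ≤⟨ +-monoˡ-≤ (- x) x≤y ⟩
    y - x  ∎

  0≤y-x⇒x≤y : ∀ {x y} → 0# ≤ y - x → x ≤ y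
  0≤y-x⇒x≤y {x} {y} 0≤y-x = begin
    x          ≈⟨ +-identityˡ x ⟨
    0# + x     ≤⟨ +-monoˡ-≤ x 0≤y-x ⟩
    y - x + x  ≈⟨ x-y+y≈x y x ⟩
    y          ∎

  *-monoˡ-≤ : ∀ {x y z} → 0# ≤ z → x ≤ y → z * x ≤ z * y
  *-monoˡ-≤ {x} {y} {z} 0≤z x≤y = 0≤y-x⇒x≤y (begin
    0#             ≤⟨ *-nonNeg 0≤z (x≤y⇒0≤y-x x≤y) ⟩
    z * (y - x)    ≈⟨ x[y-z]≈xy-xz z y x ⟩
    z * y - z * x  ∎)

  *-monoʳ-≤ : ∀ {x y z} → 0# ≤ z → x ≤ y → x * z ≤ y * z
  *-monoʳ-≤ {x} {y} {z} 0≤z x≤y = begin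
    x * z  ≈⟨ *-comm x z ⟩
    z * x  ≤⟨ *-monoˡ-≤ 0≤z x≤y ⟩
    z * y  ≈⟨ *-comm z y ⟩
    y * z  ∎

  x-y≤x : ∀ {x y} → 0# ≤ y → x - y ≤ x
  x-y≤x {x} {y} 0≤y = begin
    x - y       ≈⟨ +-comm x (- y) ⟩
    - y + x     ≈⟨ +-congʳ (+-identityˡ (- y)) ⟨
    0# - y + x  ≤⟨ +-monoˡ-≤ x (+-monoˡ-≤ (- y) 0≤y) ⟩
    y - y + x   ≈⟨ +-congʳ (-‿inverseʳ y) ⟩
    0# + x      ≈⟨ +-identityˡ x ⟩
    x           ∎

  x-[x-y]≈y : ∀ x y → x - (x - y) ≈ y
  x-[x-y]≈y x y = ∙-cancelʳ (x - y) (x - (x - y)) y (begin-equality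
    x - (x - y) + (x - y)  ≈⟨ x-y+y≈x x (x - y) ⟩
    x                      ≈⟨ x-y+y≈x x y ⟨
    x - y + y              ≈⟨ +-comm (x - y) y ⟩
    y + (x - y)            ∎)

  -- If `x ⁻¹ ≤ 0#`, multiplying by `x` gives `1# ≤ 0#`. The premise `0# ≤ 1#` is not among the
  -- axioms; for a slope it follows from `0# < p i` and `p i < 1#`.
  ⁻¹-nonNeg : ∀ {x} → 0# ≤ 1# → 0# < x → 0# ≤ x ⁻¹
  ⁻¹-nonNeg {x} 0≤1 (0≤x , 0≉x) with total 0# (x ⁻¹)
  ... | inj₁ 0≤x⁻¹ = 0≤x⁻¹
  ... | inj₂ x⁻¹≤0 = contradiction (antisym 0≤1 1≤0) 0≉1
    where
    1≤0 : 1# ≤ 0#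
    1≤0 = begin
      1#          ≈⟨ *-inverseʳ x (λ x≈0 → 0≉x (sym x≈0)) ⟨
      x * x ⁻¹    ≤⟨ *-monoˡ-≤ 0≤x x⁻¹≤0 ⟩
      x * 0#      ≈⟨ *-comm x 0# ⟩
      0# * x      ≈⟨ zeroˡ x ⟩
      0#          ∎

  -- The hypothesis `p * r + p ≈ 1#` is `r = (1 - p)/p` without division. After adding `d = a - b`
  -- to both sides, rewriting `d` as `(p * r + p) * d` lets the factor `p` collect `l + r * d + d`,
  -- which is `a`; the fixed-point equation finishes.
  affine-preimage : ∀ {p q r a} b → p * r + p ≈ 1# → p * a + q ≈ a →
                    p * (b - r * (a - b)) + q ≈ b
  affine-preimage {p} {q} {r} {a} b pr+p≈1 pa+q≈a =
    ∙-cancelʳ d (p * l + q) b (begin-equality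
      p * l + q + d                ≈⟨ +-congˡ (*-identityˡ d) ⟨
      p * l + q + 1# * d           ≈⟨ +-congˡ (*-congʳ pr+p≈1) ⟨
      -- The semiring solver treats `l` and `d` as atoms; the subtractions inside them cancel in the
      -- next two steps.
      p * l + q + (p * r + p) * d  ≈⟨ solve 5 (λ p q r l d →
        p :* l :+ q :+ (p :* r :+ p) :* d :=
        p :* (l :+ r :* d :+ d) :+ q) refl p q r l d ⟩
      p * (l + r * d + d) + q      ≈⟨ +-congʳ (*-congˡ (+-congʳ (x-y+y≈x b (r * d)))) ⟩
      p * (b + d) + q              ≈⟨ +-congʳ (*-congˡ b+d≈a) ⟩
      p * a + q                    ≈⟨ pa+q≈a ⟩
      a                            ≈⟨ b+d≈a ⟨
      b + d                        ∎)
    where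
    d l : Carrier
    d = a - b
    l = b - r * d

    b+d≈a : b + d ≈ a
    b+d≈a = trans (+-comm b d) (x-y+y≈x a b)

  -- Scan from the left and stop at the first breakpoint above `x`. Each failed test supplies the
  -- lower bound for the shifted sequence, and the hypothesis on the last breakpoint closes the
  -- final interval.
  locate : ∀ {n} (a : Fin (ℕ.suc (ℕ.suc n)) → Carrier) {x} →
           a zero ≤ x → x < a (fromℕ (ℕ.suc n)) →
           Σ[ i ∈ Fin (ℕ.suc n) ] a (inject₁ i) ≤ x × x < a (suc i)
  locate {ℕ.zero}  a a₀≤x x<a₁ = zero , a₀≤x , x<a₁
  locate {ℕ.suc n} a {x} a₀≤x x<aₙ with a (suc zero) ≤? x
  ... | no  a₁≰x = zero , a₀≤x , ≰⇒> a₁≰x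
  ... | yes a₁≤x with locate (λ i → a (suc i)) a₁≤x x<aₙ
  ...   | i , aᵢ≤x , x<aᵢ₊₁ = suc i , aᵢ≤x , x<aᵢ₊₁

module _ {c ℓ₁ ℓ₂ : Level} (ℝ : CompleteOrderedField c ℓ₁ ℓ₂) where

  open CompleteOrderedField ℝ
  open UnitInterval ℝ
  open OrderedFieldProperties ℝ
  open PartialOrderReasoning poset

  -- A single affine piece and the clauses of `decrease`.

  module PiecesProperties {n : ℕ} (P : Pieces n) where

    open Pieces P

    0≤a : ∀ i → 0# ≤ a i
    0≤a = <-weakInduction (λ i → 0# ≤ a i) (reflexive (sym a₀≈0))
            (λ i 0≤aᵢ → ≤-trans 0≤aᵢ (proj₁ (a-mono i)))

    0≤ratio : ∀ i → 0# ≤ ratio i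
    0≤ratio i = *-nonNeg (x≤y⇒0≤y-x (proj₁ (p<1 i)))
      (⁻¹-nonNeg (≤-trans (proj₁ (0<p i)) (proj₁ (p<1 i))) (0<p i))

    p*ratio+p≈1 : ∀ i → p i * ratio i + p i ≈ 1#
    p*ratio+p≈1 i = begin-equality
      p i * ((1# - p i) * p i ⁻¹) + p i  ≈⟨ +-congʳ (*-congˡ (*-comm _ _)) ⟩
      p i * (p i ⁻¹ * (1# - p i)) + p i  ≈⟨ +-congʳ (*-assoc _ _ _) ⟨
      p i * p i ⁻¹ * (1# - p i) + p i    ≈⟨ +-congʳ (*-congʳ (*-inverseʳ (p i)
                                             (λ p≈0 → proj₂ (0<p i) (sym p≈0)))) ⟩
      1# * (1# - p i) + p i              ≈⟨ +-congʳ (*-identityˡ _) ⟩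
      1# - p i + p i                     ≈⟨ x-y+y≈x 1# (p i) ⟩
      1#                                 ∎

    minRatio≤ratio : ∀ i → minRatio ≤ ratio i
    minRatio≤ratio = tabulate⁻ (Extrema.min≤xs totalOrder (ratio zero) (tabulate ratio))

    piece-mono : ∀ i {x y} → x ≤ y → piece i x ≤ piece i y
    piece-mono i x≤y = +-monoˡ-≤ (q i) (*-monoˡ-≤ (proj₁ (0<p i)) x≤y)

    -- The lower bound on `l` is returned as well, since `piece i` describes `g` only on its own
    -- interval. The left endpoint meets the first clause of `decrease` outright; the other reply
    -- still has to be compared with `minRatio`.
    piece-reply : ∀ i b → a (inject₁ i) ≤ b → b ≤ a (suc i) →
      Σ[ l ∈ Carrier ] a (inject₁ i) ≤ l × l ≤ b × b ≤ piece i l ×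
        (l ≈ a (inject₁ i) ⊎ ratio i * (a (suc i) - b) ≤ b - l)
    piece-reply i b aᵢ≤b b≤aᵢ₊₁ with a (inject₁ i) ≤? b - ratio i * (a (suc i) - b)
    ... | yes aᵢ≤l =
      b - ratio i * (a (suc i) - b) , aᵢ≤l ,
      x-y≤x (*-nonNeg (0≤ratio i) (x≤y⇒0≤y-x b≤aᵢ₊₁)) ,
      reflexive (sym (affine-preimage b (p*ratio+p≈1 i) (piece-fix i))) ,
      inj₂ (reflexive (sym (x-[x-y]≈y b _)))
    ... | no aᵢ≰l = a (inject₁ i) , ≤-refl , aᵢ≤b , b≤piece , inj₁ refl
      where
      b≤piece : b ≤ piece i (a (inject₁ i))
      b≤piece = begin
        b                                        ≈⟨ affine-preimage b (p*ratio+p≈1 i) (piece-fix i) ⟨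
        -- `piece i` is increasing on all of `Carrier`, so it may be evaluated at the preimage even
        -- though that lies left of the interval, possibly below `0#`.
        piece i (b - ratio i * (a (suc i) - b))  ≤⟨ piece-mono i (≰⇒≥ aᵢ≰l) ⟩
        piece i (a (inject₁ i))                  ∎

    -- Here `u` is the point from which `decrease` measures the distance to `b`: `v` on the last
    -- piece, the right endpoint on the others.
    minRatio-descent : ∀ i {u b l} → b ≤ u → u ≤ a (suc i) →
      ratio i * (a (suc i) - b) ≤ b - l → minRatio * (u - b) ≤ b - l
    minRatio-descent i {u} {b} {l} b≤u u≤aᵢ₊₁ h = begin
      minRatio * (u - b)         ≤⟨ *-monoʳ-≤ (x≤y⇒0≤y-x b≤u) (minRatio≤ratio i) ⟩
      ratio i * (u - b)          ≤⟨ *-monoˡ-≤ (0≤ratio i) (+-monoˡ-≤ (- b) u≤aᵢ₊₁) ⟩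
      ratio i * (a (suc i) - b)  ≤⟨ h ⟩
      b - l                      ∎

    ratio-descent⇒decrease : ∀ i {v b l} → a (inject₁ i) ≤ val b → val b < a (suc i) →
      val b ≤ val v → val v ≤ aₙ₊₁ →
      ratio i * (a (suc i) - val b) ≤ val b - val l → decrease v b l
    ratio-descent⇒decrease i aᵢ≤b b<aᵢ₊₁ b≤v v≤aₙ₊₁ h with view i
    ... | ‵fromℕ     =
      inj₂ (inj₁ (aᵢ≤b , minRatio-descent (fromℕ n) b≤v v≤aₙ₊₁ h))
    ... | ‵inject₁ j =
      inj₂ (inj₂ (j , aᵢ≤b , b<aᵢ₊₁ ,
        minRatio-descent (inject₁ j) (proj₁ b<aᵢ₊₁) ≤-refl h))

    -- Replies for `g`, and the game for functions above `g`.

    module _ (g : 𝕀 → 𝕀) (g-piecewise : IsPiecewise g) where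

      -- Strictness of `b <ᴵ v` puts `b` strictly below `aₙ₊₁`, hence into one of the half-open
      -- intervals. The reply lies between the left endpoint and `b`, so `g` acts on it by the same
      -- piece.
      piecewise-reply : ∀ v b → b <ᴵ v → val v ≤ aₙ₊₁ →
        Σ[ l ∈ 𝕀 ] b ≤ᴵ g l × l ≤ᴵ b × decrease v b l
      piecewise-reply v b b<v v≤aₙ₊₁
        with i , aᵢ≤b , b<aᵢ₊₁ ← locate a
               (≤-trans (reflexive a₀≈0) (0≤val b))
               (begin-strict
                 val b  <⟨ b<v ⟩
                 val v  ≤⟨ v≤aₙ₊₁ ⟩
                 aₙ₊₁   ∎)
        with x , aᵢ≤x , x≤b , b≤piece , x≈aᵢ⊎descent ← piece-reply i (val b) aᵢ≤b (proj₁ b<aᵢ₊₁)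
        = l , b≤gl , x≤b , l-decreases x≈aᵢ⊎descent
        where
        l : 𝕀
        l = record
          { val   = x
          ; 0≤val = ≤-trans (0≤a (inject₁ i)) aᵢ≤x
          ; val≤1 = ≤-trans x≤b (val≤1 b)
          }

        x<aᵢ₊₁ : x < a (suc i)
        x<aᵢ₊₁ = begin-strict
          x          ≤⟨ x≤b ⟩
          val b      <⟨ b<aᵢ₊₁ ⟩
          a (suc i)  ∎

        b≤gl : b ≤ᴵ g l
        b≤gl = begin
          val b      ≤⟨ b≤piece ⟩
          piece i x  ≈⟨ proj₁ g-piecewise l i aᵢ≤x x<aᵢ₊₁ ⟨
          val (g l)  ∎

        l-decreases : x ≈ a (inject₁ i) ⊎ ratio i * (a (suc i) - val b) ≤ val b - x →
                      decrease v b l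
        l-decreases (inj₁ x≈aᵢ) = inj₁ (i , x≈aᵢ)
        l-decreases (inj₂ h)    =
          ratio-descent⇒decrease i {v} {b} {l} aᵢ≤b b<aᵢ₊₁ (proj₁ b<v) v≤aₙ₊₁ h

      -- The point `aₙ₊₁` lies in none of the half-open intervals, but the second clause of
      -- `IsPiecewise` covers it and makes it a fixpoint of `g`.
      piecewise-lfp≤aₙ₊₁ : ∀ μg → IsLeastFixpoint g μg → val μg ≤ aₙ₊₁
      piecewise-lfp≤aₙ₊₁ _ (_ , least) = least top g-top≈top
        where
        top : 𝕀
        top = record { val = aₙ₊₁ ; 0≤val = 0≤a (fromℕ (ℕ.suc n)) ; val≤1 = aₙ₊₁≤1 }

        g-top≈top : g top ≈ᴵ top
        g-top≈top = trans (proj₂ g-piecewise top (proj₁ (a-mono (fromℕ n))))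
                          (piece-fix (fromℕ n))

      module _ {β : Level} (B : Pred 𝕀 β) (0∉B : ∀ b → b ∈ B → ¬ (val b ≈ 0#)) where

        -- A reply for `g` remains legal for `f` because `b ≤ g l ≤ f l`, and the winning condition
        -- does not mention the function. Bounding `v` by `aₙ₊₁` rather than by a fixpoint lets both
        -- halves of the theorem share this result.
        ∃-wins-dominating : ∀ f → (∀ x → g x ≤ᴵ f x) →
                       ∀ v → val v ≤ aₙ₊₁ → Game.∃-wins B decrease f v
        ∃-wins-dominating f g≤f v v≤aₙ₊₁ =
          (λ m → record { l = proj₁ (reply m)
                        ; b≤fl = ≤-trans (proj₁ (proj₂ (reply m))) (g≤f (proj₁ (reply m))) }) ,
          λ m → proj₂ (proj₂ (reply m))
          where
          open Game B decrease f
          open Move∀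

          b<v : (m : Move∀ v) → b m <ᴵ v
          b<v m with b≪v m
          ... | inj₁ b<v = b<v
          ... | inj₂ b≈0 = contradiction b≈0 (0∉B (b m) (b∈B m))

          reply : (m : Move∀ v) → Σ[ l ∈ 𝕀 ] b m ≤ᴵ g l × l ≤ᴵ b m × decrease v (b m) l
          reply m = piecewise-reply v (b m) (b<v m) v≤aₙ₊₁

lemma7p8 :
  {c ℓ₁ ℓ₂ β : Level} (ℝ : CompleteOrderedField c ℓ₁ ℓ₂) →
  let open CompleteOrderedField ℝ
      open UnitInterval ℝ
  in
  (B : Pred 𝕀 β) → IsBasis B → (∀ b → b ∈ B → ¬ (val b ≈ 0#)) →
  (n : ℕ) (P : Pieces n) →
  let open Pieces P in
  (g : 𝕀 → 𝕀) → IsPiecewise g →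
  Game.Complete B decrease g ×
  (∀ f → Monotone f → (∀ x → g x ≤ᴵ f x) →
     ∀ μf → IsLeastFixpoint f μf → val μf ≈ aₙ₊₁ →
     ∀ v → v ≤ᴵ μf → Game.∃-wins B decrease f v)
lemma7p8 ℝ B _ 0∉B n P g g-piecewise =
  (λ μg μg-least v v≤μg →
     wins g (λ _ → ≤-refl) v (≤-trans v≤μg (piecewise-lfp≤aₙ₊₁ g g-piecewise μg μg-least))) ,
  (λ f _ g≤f μf _ μf≈aₙ₊₁ v v≤μf →
     wins f g≤f v (≤-trans v≤μf (reflexive μf≈aₙ₊₁)))
  where
  open CompleteOrderedField ℝ
  open OrderedFieldProperties ℝ
  open PiecesProperties ℝ P
  wins = ∃-wins-dominating g g-piecewise B 0∉B
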